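{- If there is a nontrivial automorphism of $\mathcal P(\omega)/\mathrm{Fin}$, then either there is a nontrivial automorphism $\phi$ of $\mathcal P(\omega)/\mathrm{Fin}$ with $\phi\circ\sigma=\sigma\circ\phi$, or there is a nontrivial automorphism $\psi$ of $\mathcal P(\omega)/\mathrm{Fin}$ such that $\langle\mathcal P(\omega)/\mathrm{Fin},\psi\rangle$ and $\langle\mathcal P(\omega)/\mathrm{Fin},\sigma\rangle$ are conjugate.
   Context: $\mathcal P(\omega)/\mathrm{Fin}$ is $\mathcal P(\omega)$ modulo finite sets, $\sigma([A])=[A+1]$. An automorphism $\tau$ of $\mathcal P(\omega)/\mathrm{Fin}$ is trivial if there is a function $t:\omega\to\omega$ with $\tau([A])=[t[A]]$ for all $A\subseteq\omega$; otherwise nontrivial. Systems $\langle\mathbb A,\alpha\rangle,\langle\mathbb B,\beta\rangle$ are conjugate if some Boolean isomorphism $\phi:\mathbb A\to\mathbb B$ satisfies $\phi\circ\alpha=\beta\circ\phi$. No hypothesis beyond ZFC. -}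

module Defs where

open import Level using (0ℓ)
open import Data.Nat using (ℕ; zero; suc; _≥_)
open import Data.Product using (Σ; ∃; _×_; _,_)
open import Data.Empty using (⊥)
open import Relation.Nullary using (¬_)
open import Relation.Binary.PropositionalEquality using (_≡_)
open import Function.Bundles using (_⇔_)

Sub : Set₁
Sub = ℕ → Set

-- A =* B : A and B differ by a finite set (equality in P(ω)/Fin).
_=*_ : Sub → Sub → Set
A =* B = ∃ λ N → ∀ n → n ≥ N → (A n ⇔ B n)

infix 4 _=*_

∁ : Sub → Sub
∁ A n = ¬ A n

_∩_ : Sub → Sub → Sub
(A ∩ B) n = A n × B n

shift : Sub → Sub
shift A zero    = ⊥
shift A (suc n) = A n

image : (ℕ → ℕ) → Sub → Sub
image t A n = ∃ λ a → A a × (t a ≡ n)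

-- An automorphism of P(ω)/Fin, given by a lift f : P(ω) → P(ω) which
-- respects =*, induces a Boolean homomorphism of the quotient
-- (preserves complement and meet mod Fin), and is bijective on classes.
record Aut : Set₁ where
  field
    f      : Sub → Sub
    resp   : ∀ {A B} → A =* B → f A =* f B
    hom-∁  : ∀ A → f (∁ A) =* ∁ (f A)
    hom-∩  : ∀ A B → f (A ∩ B) =* (f A ∩ f B)
    inj    : ∀ {A B} → f A =* f B → A =* B
    surj   : ∀ B → ∃ λ A → f A =* B

open Aut public

Trivial : Aut → Set₁
Trivial τ = ∃ λ (t : ℕ → ℕ) → ∀ A → f τ A =* image t A

Nontrivial : Aut → Set₁
Nontrivial τ = ¬ Trivial τ

CommutesWithShift : Aut → Set₁
CommutesWithShift φ = ∀ A → f φ (shift A) =* shift (f φ A)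

ConjugateToShift : Aut → Set₁
ConjugateToShift ψ = Σ Aut λ Φ → ∀ A → f Φ (f ψ A) =* shift (f Φ A)

{-# OPTIONS --safe #-}

-- Let τ be a nontrivial automorphism and let Φ act as τ on the even numbers
-- (identified with ω) and as the identity on the odd numbers.  The conjugate
-- ψ = Φ⁻¹ ∘ σ ∘ Φ sends 2Z to 2τ(Z) + 1, so a function inducing ψ would yield
-- one inducing τ.  Hence the second alternative always holds.
module Submission where

open import Defs
open import Level using (0ℓ)
import Level
open import Data.Product using (Σ; _×_; _,_; proj₁; proj₂)
open import Data.Sum using (_⊎_; inj₂)
open import Axiom.ExcludedMiddle using (ExcludedMiddle)
open import Data.Empty using (⊥; ⊥-elim)
open import Data.Nat using (ℕ; zero; suc; _≥_; _≤_; _⊔_; z≤n; s≤s)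
open import Data.Nat.Properties using (≤-trans; m≤m⊔n; m≤n⊔m; m≤n⇒m≤1+n)
open import Data.Product.Function.NonDependent.Propositional using (_×-⇔_)
open import Function using (_∘_; id; const)
open import Function.Bundles using (_⇔_; mk⇔)
open import Function.Properties.Equivalence using (⇔-isEquivalence)
open import Function.Related.Propositional using (≡⇒; equivalence)
open import Function.Related.TypeIsomorphisms using (¬-cong-⇔)
open import Relation.Binary.Bundles using (Setoid)
open import Relation.Binary.PropositionalEquality
  using (_≡_; refl; sym; trans; cong; subst)
open import Relation.Binary.Structures using (IsEquivalence)
import Relation.Binary.Reasoning.Setoid as SetoidReasoning

-- Congruence properties of equality modulo finite sets

private
  module ⇔ = IsEquivalence (⇔-isEquivalence {0ℓ})

pointwise : ∀ {A B : Sub} → (∀ n → A n ≡ B n) → A =* B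
pointwise e = 0 , λ n _ → ≡⇒ {k = equivalence} (e n)

=*-refl : ∀ {A} → A =* A
=*-refl = 0 , λ _ _ → ⇔.refl

=*-sym : ∀ {A B} → A =* B → B =* A
=*-sym (N , e) = N , λ n n≥N → ⇔.sym (e n n≥N)

=*-zipWith : ∀ {A A′ B B′ C C′ : Sub} →
  (∀ n → A n ⇔ A′ n → B n ⇔ B′ n → C n ⇔ C′ n) →
  A =* A′ → B =* B′ → C =* C′
=*-zipWith op (M , d) (N , e) = M ⊔ N , λ n n≥ →
  op n (d n (≤-trans (m≤m⊔n M N) n≥)) (e n (≤-trans (m≤n⊔m M N) n≥))

=*-trans : ∀ {A B C} → A =* B → B =* C → A =* C
=*-trans = =*-zipWith (λ _ → ⇔.trans)

=*-setoid : Setoid _ _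
=*-setoid = record
  { Carrier = Sub
  ; _≈_ = _=*_
  ; isEquivalence = record { refl = =*-refl ; sym = =*-sym ; trans = =*-trans }
  }

open SetoidReasoning =*-setoid

∩-cong : ∀ {A A′ B B′} → A =* A′ → B =* B′ → (A ∩ B) =* (A′ ∩ B′)
∩-cong = =*-zipWith (λ _ → _×-⇔_)

∁-cong : ∀ {A B} → A =* B → ∁ A =* ∁ B
∁-cong (N , e) = N , λ n n≥N → ¬-cong-⇔ (e n n≥N)

-- Composites and inverses of automorphisms, and the shift

_∘ᵃ_ : Aut → Aut → Aut
f (τ ∘ᵃ ρ) = f τ ∘ f ρ
resp (τ ∘ᵃ ρ) = resp τ ∘ resp ρ
hom-∁ (τ ∘ᵃ ρ) A = =*-trans (resp τ (hom-∁ ρ A)) (hom-∁ τ (f ρ A))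
hom-∩ (τ ∘ᵃ ρ) A B =
  =*-trans (resp τ (hom-∩ ρ A B)) (hom-∩ τ (f ρ A) (f ρ B))
inj (τ ∘ᵃ ρ) = inj ρ ∘ inj τ
surj (τ ∘ᵃ ρ) C =
  let B , τB=C = surj τ C
      A , ρA=B = surj ρ B
  in A , =*-trans (resp τ ρA=B) τB=C

preimage : Aut → Sub → Sub
preimage τ B = proj₁ (surj τ B)

f-preimage : ∀ τ B → f τ (preimage τ B) =* B
f-preimage τ B = proj₂ (surj τ B)

-- The preimages chosen by `surj` are unique only up to `=*`. Hence `resp`, `hom-∁` and `hom-∩` are
-- checked after applying `f τ`, which `inj τ` then cancels.
_⁻¹ : Aut → Aut
f (τ ⁻¹) = preimage τ
resp (τ ⁻¹) {A} {B} A=B = inj τ (begin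
  f τ (preimage τ A)  ≈⟨ f-preimage τ A ⟩
  A                   ≈⟨ A=B ⟩
  B                   ≈⟨ f-preimage τ B ⟨
  f τ (preimage τ B)  ∎)
hom-∁ (τ ⁻¹) A = inj τ (begin
  f τ (preimage τ (∁ A))    ≈⟨ f-preimage τ (∁ A) ⟩
  ∁ A                       ≈⟨ ∁-cong (f-preimage τ A) ⟨
  ∁ (f τ (preimage τ A))    ≈⟨ hom-∁ τ (preimage τ A) ⟨
  f τ (∁ (preimage τ A))    ∎)
hom-∩ (τ ⁻¹) A B = inj τ (begin
  f τ (preimage τ (A ∩ B))                    ≈⟨ f-preimage τ (A ∩ B) ⟩
  A ∩ B                                       ≈⟨ ∩-cong (f-preimage τ A) (f-preimage τ B) ⟨
  f τ (preimage τ A) ∩ f τ (preimage τ B)     ≈⟨ hom-∩ τ (preimage τ A) (preimage τ B) ⟨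
  f τ (preimage τ A ∩ preimage τ B)           ∎)
inj (τ ⁻¹) {A} {B} eq = begin
  A                   ≈⟨ f-preimage τ A ⟨
  f τ (preimage τ A)  ≈⟨ resp τ eq ⟩
  f τ (preimage τ B)  ≈⟨ f-preimage τ B ⟩
  B                   ∎
surj (τ ⁻¹) B = f τ B , inj τ (f-preimage τ (f τ B))

σ : Aut
f σ = shift
resp σ (N , e) = suc N , λ { (suc n) (s≤s n≥N) → e n n≥N }
-- The bound 1 skips 0, which lies in `∁ (shift A)` but not in `shift (∁ A)`.
hom-∁ σ A = 1 , λ { (suc n) _ → ⇔.refl }
hom-∩ σ A B = 1 , λ { (suc n) _ → ⇔.refl }
inj σ (N , e) = N , λ n n≥N → e (suc n) (m≤n⇒m≤1+n n≥N)
-- If 0 is in `B`, it is lost here; this changes `B` only by a finite set.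
surj σ B = B ∘ suc , 1 , λ { (suc n) _ → ⇔.refl }

-- Splitting subsets of ω into even and odd halves

double : ℕ → ℕ
double zero    = zero
double (suc n) = suc (suc (double n))

data Parity : ℕ → Set where
  even : ∀ k → Parity (double k)
  odd  : ∀ k → Parity (suc (double k))

parity : ∀ n → Parity n
parity zero = even zero
parity (suc n) with parity n
... | even k = odd k
... | odd k  = even (suc k)

n≤double : ∀ n → n ≤ double n
n≤double zero    = z≤n
n≤double (suc n) = s≤s (m≤n⇒m≤1+n (n≤double n))

-- The slack of one lets a single bound serve both `double k` and `suc (double k)`.
double≤1+double⇒≤ : ∀ m n → double m ≤ suc (double n) → m ≤ n
double≤1+double⇒≤ zero    n       _             = z≤n
double≤1+double⇒≤ (suc m) zero    (s≤s ())
double≤1+double⇒≤ (suc m) (suc n) (s≤s (s≤s h)) = s≤s (double≤1+double⇒≤ m n h)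

-- The two sequences swap roles at each step. The type `X` is `Set` for subsets and `ℕ` for
-- `oddHalf`, hence the level parameter.
interleave : ∀ {ℓ} {X : Set ℓ} → (ℕ → X) → (ℕ → X) → ℕ → X
interleave a b zero    = a zero
interleave a b (suc n) = interleave b (a ∘ suc) n

interleave-even : ∀ {ℓ} {X : Set ℓ} (a b : ℕ → X) n →
  interleave a b (double n) ≡ a n
interleave-even a b zero    = refl
interleave-even a b (suc n) = interleave-even (a ∘ suc) (b ∘ suc) n

interleave-odd : ∀ {ℓ} {X : Set ℓ} (a b : ℕ → X) n →
  interleave a b (suc (double n)) ≡ b n
interleave-odd a b n = interleave-even b (a ∘ suc) n

evens odds : Sub → Sub
evens A n = A (double n)
odds  A n = A (suc (double n))

evens-cong : ∀ {A B} → A =* B → evens A =* evens B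
evens-cong (N , e) = N , λ n n≥N → e _ (≤-trans n≥N (n≤double n))

odds-cong : ∀ {A B} → A =* B → odds A =* odds B
odds-cong (N , e) = N , λ n n≥N → e _ (m≤n⇒m≤1+n (≤-trans n≥N (n≤double n)))

-- An index past twice the larger bound has its half past both bounds.
evens-odds-injective : ∀ {A B} → evens A =* evens B → odds A =* odds B → A =* B
evens-odds-injective {A} {B} (M , d) (N , e) = double (M ⊔ N) , λ n → go (parity n)
  where
  go : ∀ {n} → Parity n → n ≥ double (M ⊔ N) → A n ⇔ B n
  go (even k) h = d k (≤-trans (m≤m⊔n M N) (double≤1+double⇒≤ (M ⊔ N) k (m≤n⇒m≤1+n h)))
  go (odd k)  h = e k (≤-trans (m≤n⊔m M N) (double≤1+double⇒≤ (M ⊔ N) k h))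

evens-interleave : ∀ A B → evens (interleave A B) =* A
evens-interleave A B = pointwise (interleave-even A B)

odds-interleave : ∀ A B → odds (interleave A B) =* B
odds-interleave A B = pointwise (interleave-odd A B)

-- The automorphism acting as τ on the evens, and the conjugate of the shift

-- This is the product of `τ` and the identity under the splitting of P(ω)/Fin into two copies of
-- itself, one for each parity.
onEvens : Aut → Aut
onEvens τ = record
  { f = g
  ; resp = λ {A} {B} A=B → ext A (g B)
      (=*-trans (resp τ (evens-cong A=B)) (=*-sym (g-evens B)))
      (=*-trans (odds-cong A=B) (=*-sym (g-odds B)))
  ; hom-∁ = λ A → ext (∁ A) (∁ (g A))
      (=*-trans (hom-∁ τ (evens A)) (=*-sym (∁-cong (g-evens A))))
      (=*-sym (∁-cong (g-odds A)))
  ; hom-∩ = λ A B → ext (A ∩ B) (g A ∩ g B)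
      (=*-trans (hom-∩ τ (evens A) (evens B)) (=*-sym (∩-cong (g-evens A) (g-evens B))))
      (=*-sym (∩-cong (g-odds A) (g-odds B)))
  ; inj = λ {A} {B} gA=gB → evens-odds-injective
      (inj τ (=*-trans (=*-sym (g-evens A)) (=*-trans (evens-cong gA=gB) (g-evens B))))
      (=*-trans (=*-sym (g-odds A)) (=*-trans (odds-cong gA=gB) (g-odds B)))
  ; surj = λ B →
      let P = preimage τ (evens B) in
      interleave P (odds B) , ext (interleave P (odds B)) B
        (=*-trans (resp τ (evens-interleave P (odds B))) (f-preimage τ (evens B)))
        (odds-interleave P (odds B))
  }
  where
  g : Sub → Sub
  g A = interleave (f τ (evens A)) (odds A)

  g-evens : ∀ A → evens (g A) =* f τ (evens A)
  g-evens A = evens-interleave (f τ (evens A)) (odds A)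

  g-odds : ∀ A → odds (g A) =* odds A
  g-odds A = odds-interleave (f τ (evens A)) (odds A)

  ext : ∀ A B → f τ (evens A) =* evens B → odds A =* odds B → g A =* B
  ext A B p q = evens-odds-injective (=*-trans (g-evens A) p) (=*-trans (g-odds A) q)

conjugate : Aut → Aut
conjugate τ = (onEvens τ ⁻¹) ∘ᵃ (σ ∘ᵃ onEvens τ)

conjugate-conjugateToShift : ∀ τ → ConjugateToShift (conjugate τ)
conjugate-conjugateToShift τ = onEvens τ , λ A → f-preimage (onEvens τ) (shift (f (onEvens τ) A))

-- `onEvens τ` leaves odd halves alone, while the shift turns the even half, where `τ` has acted,
-- into the odd half.
odds-conjugate : ∀ τ A → odds (f (conjugate τ) A) =* f τ (evens A)
odds-conjugate τ A = begin
  odds ψA                        ≈⟨ odds-interleave (f τ (evens ψA)) (odds ψA) ⟨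
  -- The right side is an odd half of a shift; `odds (shift B)` unfolds to `evens B`.
  odds (f (onEvens τ) ψA)        ≈⟨ odds-cong (proj₂ (conjugate-conjugateToShift τ) A) ⟩
  evens (f (onEvens τ) A)        ≈⟨ evens-interleave (f τ (evens A)) (odds A) ⟩
  f τ (evens A)                  ∎
  where ψA = f (conjugate τ) A

-- Junk value 0 at even arguments.
oddHalf : ℕ → ℕ
oddHalf = interleave (const 0) id

-- Finitely many values may be ignored, which absorbs the junk value of oddHalf.
image-oddHalf : ∀ t Z →
  image (oddHalf ∘ t ∘ double) Z =* odds (image t (interleave Z (const ⊥)))
image-oddHalf t Z = 1 , λ n n≥1 → mk⇔ (to n≥1) from
  where
  A = interleave Z (const ⊥)

  oddHalf≡⇒ : ∀ {m n} → Parity m → n ≥ 1 → oddHalf m ≡ n → m ≡ suc (double n)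
  oddHalf≡⇒ (even k) n≥1 eq with trans (sym (interleave-even (const 0) id k)) eq
  -- Matching on `refl` makes `n` the junk value 0, against `n ≥ 1`.
  oddHalf≡⇒ (even k) ()  eq | refl
  oddHalf≡⇒ (odd k)  _   eq =
    cong (suc ∘ double) (trans (sym (interleave-odd (const 0) id k)) eq)

  to : ∀ {n} → n ≥ 1 → image (oddHalf ∘ t ∘ double) Z n → odds (image t A) n
  to n≥1 (z , Zz , eq) = double z
    , subst id (sym (interleave-even Z (const ⊥) z)) Zz
    , oddHalf≡⇒ (parity (t (double z))) n≥1 eq

  from : ∀ {n} → odds (image t A) n → image (oddHalf ∘ t ∘ double) Z n
  from {n} (a , Aa , eq) with parity a
  ... | even z = z , subst id (interleave-even Z (const ⊥) z) Aa
               , trans (cong oddHalf eq) (interleave-odd (const 0) id n)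
  -- The set `A` has no odd members.
  ... | odd z  = ⊥-elim (subst id (interleave-odd Z (const ⊥) z) Aa)

-- Apply the conjugate to the set of doubles of members of `Z`: modulo finite sets, the odd half of
-- the result is `f τ Z`. If `t` induces the conjugate, then doubling, applying `t` and halving odd
-- values induces `τ`.
conjugate-trivial⇒trivial : ∀ τ → Trivial (conjugate τ) → Trivial τ
conjugate-trivial⇒trivial τ (t , induces) = oddHalf ∘ t ∘ double , λ Z →
  let A = interleave Z (const ⊥) in begin
  f τ Z                           ≈⟨ resp τ (evens-interleave Z (const ⊥)) ⟨
  f τ (evens A)                   ≈⟨ odds-conjugate τ A ⟨
  odds (f (conjugate τ) A)        ≈⟨ odds-cong (induces A) ⟩
  odds (image t A)                ≈⟨ image-oddHalf t Z ⟨
  image (oddHalf ∘ t ∘ double) Z  ∎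

theorem12p11 : ExcludedMiddle (Level.suc 0ℓ) →
    Σ Aut Nontrivial →
    (Σ Aut (λ φ → Nontrivial φ × CommutesWithShift φ))
    ⊎ (Σ Aut (λ ψ → Nontrivial ψ × ConjugateToShift ψ))
theorem12p11 _ (τ , τ-nontrivial) =
  inj₂ (conjugate τ , τ-nontrivial ∘ conjugate-trivial⇒trivial τ , conjugate-conjugateToShift τ)
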